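{- Let $H_1$ and $H_2$ be distinct simple graphs with vertex set $[n]$. Then $H_1-H_2$ is not a modular relation for $X$ (and thus also not a modular relation for $XB$).
   Context: Write $[n]=\{1,\dots,n\}$, $n\ge1$. A graph is a finite vertex set $V(G)$ together with a finite multiset $E(G)$ of unordered pairs of not necessarily distinct vertices; it is simple if it has no loops and no multi-edges. Graphs are labelled: $H_1$ and $H_2$ are distinct if $E(H_1)\ne E(H_2)$ (they may be isomorphic). $\mathbb{G}$ is the $\mathbb{C}$-vector space freely generated by all graphs whose vertex set is $[n]$ for some $n\ge 1$; $\mathbb{G}[t]$ consists of formal linear combinations of such graphs with coefficients in $\mathbb{C}[t]$. Chromatic symmetric function: $X_G=\sum_{\kappa}\prod_{v\in V(G)}x_{\kappa(v)}$, summed over maps $\kappa:V(G)\to\{1,2,3,\dots\}$ with $\kappa(v_1)\ne\kappa(v_2)$ whenever $v_1v_2\in E(G)$ (so $X_G=0$ if $G$ has a loop). Tutte symmetric function: $XB_G=\sum_{\kappa}(1+t)^{e(\kappa)}\prod_{v\in V(G)}x_{\kappa(v)}$, summed over all maps $\kappa:V(G)\to\{1,2,3,\dots\}$, where $e(\kappa)$ is the number of edges of $G$ (with multiplicity, including loops) whose endpoints receive the same value. Extend linearly to $X:\mathbb{G}\to\Lambda$ and $\mathbb{C}[t]$-linearly to $XB:\mathbb{G}[t]\to\Lambda[t]$, where $\Lambda$ is the algebra of symmetric functions over $\mathbb{C}$ in $x_1,x_2,\dots$. Extension: $G\uplus E$ denotes the graph with vertex set $V(G)$ and edge multiset $E(G)\uplus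 E$ (multiplicities are added). For $L=\sum_i c_iH_i$ with all $H_i$ graphs on $[n]$ (coefficients in $\mathbb{C}$ or $\mathbb{C}[t]$) and a graph $G$ on $[N]$, $N\ge n$, set $Ext(L;G)=\sum_i c_i\,(G\uplus E(H_i))$. Modular relation: a linear combination $L$ of graphs with vertex set $[n]$ in $\mathbb{G}$ (resp. $\mathbb{G}[t]$) is a modular relation for $X$ (resp. for $XB$) if for every $N\ge n$ and every graph $G$ with vertex set $[N]$, $Ext(L;G)$ lies in $Ker(X)$ (resp. $Ker(XB)$). -}

module Defs where

open import Algebra.Bundles using (CommutativeMonoid; CommutativeRing)
import Algebra.Solver.Ring.NaturalCoefficients.Default as NatSolver
open import Data.Bool.Base using (true; false; if_then_else_; _∧_)
open import Data.Fin.Base using (Fin; zero; suc; inject₁; fromℕ; fromℕ<; toℕ)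
import Data.Fin.Permutation as Perm
open import Data.Fin.Permutation using (Permutation′; _⟨$⟩ʳ_; _⟨$⟩ˡ_)
import Data.Fin.Properties as Finₚ
open import Data.List.Base using (List; []; _∷_; map)
open import Data.Nat.Base as ℕ using (ℕ; zero; suc; _⊔_)
import Data.Nat.Properties as ℕₚ
open import Data.Product.Base using (_×_; _,_; ∃-syntax; proj₁; proj₂)
open import Data.Vec.Base as Vec using (Vec; []; _∷_; _∷ʳ_; tabulate; lookup; count; sum)
import Data.Vec.Properties as Vecₚ
open import Data.Vec.Relation.Unary.Any using (Any; here; there)
open import Function.Base using (_∘_)
open import Function.Bundles using (_⇔_; mk⇔; module Equivalence)
open import Function.Definitions using (Injective)
open import Level using (0ℓ) renaming (_⊔_ to _⊔ˡ_)
open import Relation.Binary.PropositionalEquality as ≡ using (_≡_; _≢_)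
import Relation.Binary.Reasoning.Setoid as SetoidReasoning
open import Relation.Nullary using (¬_; Dec; does; yes; no; ¬?)
open import Relation.Nullary.Decidable using (does-⇔; dec-false; dec-true; _→-dec_)

module Real where
  open import Data.Rational.Base hiding (_⊔_)
  open import Data.Rational.Properties
  open import Data.Rational.Solver using (module +-*-Solver)
  open +-*-Solver using (solve; _:+_; _:*_; _:-_; :-_; _:=_)

  -- For Cauchy sequences this is equality of limits.  Reflexivity at x says
  -- precisely that x is Cauchy.
  infix 4 _~_
  record _~_ (x y : ℕ → ℚ) : Set where
    constructor close
    field
      closeTo : ∀ ε → 0ℚ < ε → ∃[ N ] (∀ m n → N ℕ.≤ m → N ℕ.≤ n → ∣ x m - y n ∣ < ε)

  open _~_ public

  record ℝ : Set where
    constructor mkℝ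
    field
      seq    : ℕ → ℚ
      cauchy : seq ~ seq

  open ℝ public

  private
    half : ∀ ε → 0ℚ < ε → 0ℚ < ½ * ε
    half ε 0<ε = ≡.subst (_< ½ * ε) (*-zeroʳ ½) (*-monoʳ-<-pos ½ {0ℚ} {ε} 0<ε)

    halves : ∀ ε → ½ * ε + ½ * ε ≡ ε
    halves ε = ≡.trans (≡.sym (*-distribʳ-+ ε ½ ½)) (*-identityˡ ε)

    triangle : ∀ ε a b {c} → c ≡ a + b → ∣ a ∣ < ½ * ε → ∣ b ∣ < ½ * ε → ∣ c ∣ < ε
    triangle ε a b ≡.refl p q =
      ≡.subst (∣ a + b ∣ <_) (halves ε) (≤-<-trans (∣p+q∣≤∣p∣+∣q∣ a b) (+-mono-< {∣ a ∣} {½ * ε} {∣ b ∣} {½ * ε} p q))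

    -- Two conditions holding eventually hold eventually at the same time.
    both : ∀ {P Q S : ℕ → ℕ → Set} → (∀ {m n} → P m n → Q m n → S m n) →
           ∃[ N ] (∀ m n → N ℕ.≤ m → N ℕ.≤ n → P m n) →
           ∃[ N ] (∀ m n → N ℕ.≤ m → N ℕ.≤ n → Q m n) →
           ∃[ N ] (∀ m n → N ℕ.≤ m → N ℕ.≤ n → S m n)
    both f (M , p) (N , q) = M ⊔ N , λ m n i j →
      f (p m n (ℕₚ.m⊔n≤o⇒m≤o M N i) (ℕₚ.m⊔n≤o⇒m≤o M N j))
        (q m n (ℕₚ.m⊔n≤o⇒n≤o M N i) (ℕₚ.m⊔n≤o⇒n≤o M N j))

  ~-sym : ∀ {x y} → x ~ y → y ~ x
  ~-sym {x} {y} p .closeTo ε 0<ε =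
    let N , h = p .closeTo ε 0<ε in N , λ m n i j → ≡.subst (_< ε) (flip (x n) (y m)) (h n m j i)
    where
    flip : ∀ a b → ∣ a - b ∣ ≡ ∣ b - a ∣
    flip a b = ≡.trans (≡.sym (∣-p∣≡∣p∣ (a - b)))
      (≡.cong ∣_∣ (solve 2 (λ a b → :- (a :- b) := b :- a) ≡.refl a b))

  ~-trans : ∀ {x y z} → x ~ y → y ~ z → x ~ z
  ~-trans {x} {y} {z} p q .closeTo ε 0<ε =
    let M , f = p .closeTo (½ * ε) (half ε 0<ε)
        N , g = q .closeTo (½ * ε) (half ε 0<ε)
    in M ⊔ N , λ m n i j → triangle ε (x m - y n) (y n - z n)
    (solve 3 (λ a b c → a :- c := (a :- b) :+ (b :- c)) ≡.refl (x m) (y n) (z n))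
    (f m n (ℕₚ.m⊔n≤o⇒m≤o M N i) (ℕₚ.m⊔n≤o⇒m≤o M N j))
    (g n n (ℕₚ.m⊔n≤o⇒n≤o M N j) (ℕₚ.m⊔n≤o⇒n≤o M N j))

  ~-respʳ : ∀ {x y z} → (∀ n → y n ≡ z n) → x ~ y → x ~ z
  ~-respʳ {x} y≗z p .closeTo ε 0<ε =
    let N , h = p .closeTo ε 0<ε in N , λ m n i j → ≡.subst (λ q → ∣ x m - q ∣ < ε) (y≗z n) (h m n i j)

  +-cong~ : ∀ {x x′ y y′} → x ~ x′ → y ~ y′ → (λ n → x n + y n) ~ (λ n → x′ n + y′ n)
  +-cong~ {x} {x′} {y} {y′} p q .closeTo ε 0<ε =
    both (λ {m} {n} → triangle ε (x m - x′ n) (y m - y′ n)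
           (solve 4 (λ a b c d → (a :+ b) :- (c :+ d) := (a :- c) :+ (b :- d)) ≡.refl
              (x m) (y m) (x′ n) (y′ n)))
         (p .closeTo (½ * ε) (half ε 0<ε)) (q .closeTo (½ * ε) (half ε 0<ε))

  -‿cong~ : ∀ {x y} → x ~ y → (λ n → - x n) ~ (λ n → - y n)
  -‿cong~ {x} {y} p .closeTo ε 0<ε =
    let N , h = p .closeTo ε 0<ε in N , λ m n i j → ≡.subst (_< ε) (eq (x m) (y n)) (h m n i j)
    where
    eq : ∀ a b → ∣ a - b ∣ ≡ ∣ - a - - b ∣
    eq a b = ≡.trans (≡.sym (∣-p∣≡∣p∣ (a - b)))
      (≡.cong ∣_∣ (solve 2 (λ a b → :- (a :- b) := (:- a) :- (:- b)) ≡.refl a b))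

  private
    bounded : ∀ {x} → x ~ x →
              ∃[ B ] Positive B × ∃[ N ] (∀ n → N ℕ.≤ n → ∣ x n ∣ < B)
    bounded {x} p =
      let N , h = p .closeTo 1ℚ (positive⁻¹ 1ℚ) in 1ℚ + ∣ x N ∣ , pos+nonNeg⇒pos 1ℚ ∣ x N ∣ {{∣-∣-nonNeg (x N)}} , N , λ n i →
      ≤-<-trans
        (≡.subst (λ q → ∣ q ∣ ≤ ∣ x n - x N ∣ + ∣ x N ∣)
          (solve 2 (λ a b → (a :- b) :+ b := a) ≡.refl (x n) (x N))
          (∣p+q∣≤∣p∣+∣q∣ (x n - x N) (x N)))
        (+-monoˡ-< ∣ x N ∣ {∣ x n - x N ∣} {1ℚ} (h n N i ℕₚ.≤-refl))

    module Scaled (B : ℚ) {{B⁺ : Positive B}} where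
      instance
        B≢0 : NonZero B
        B≢0 = pos⇒nonZero B
        B⁻¹⁺ : Positive (1/ B)
        B⁻¹⁺ = 1/pos⇒pos B

      scaled⁺ : ∀ ε → 0ℚ < ε → 0ℚ < 1/ B * ε
      scaled⁺ ε 0<ε = ≡.subst (_< 1/ B * ε) (*-zeroʳ (1/ B)) (*-monoʳ-<-pos (1/ B) {0ℚ} {ε} 0<ε)

      scaled-* : ∀ ε a b → 0ℚ < ε → ∣ a ∣ < B → ∣ b ∣ < 1/ B * ε → ∣ a * b ∣ < ε
      scaled-* ε a b 0<ε p q = begin-strict
        ∣ a * b ∣        ≡⟨ ∣p*q∣≡∣p∣*∣q∣ a b ⟩
        ∣ a ∣ * ∣ b ∣    ≤⟨ *-monoʳ-≤-nonNeg ∣ b ∣ {{∣-∣-nonNeg b}} {∣ a ∣} {B} (<⇒≤ p) ⟩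
        B * ∣ b ∣        <⟨ *-monoʳ-<-pos B {∣ b ∣} {1/ B * ε} q ⟩
        B * (1/ B * ε)   ≡⟨ *-assoc B (1/ B) ε ⟨
        B * 1/ B * ε     ≡⟨ ≡.cong (_* ε) (*-inverseʳ B) ⟩
        1ℚ * ε           ≡⟨ *-identityˡ ε ⟩
        ε                ∎
        where open ≤-Reasoning

  *-cong~ : ∀ {x x′ y y′} → x ~ x′ → y ~ y′ → (λ n → x n * y n) ~ (λ n → x′ n * y′ n)
  *-cong~ {x} {x′} {y} {y′} p q .closeTo ε 0<ε =
    both (λ {m} {n} → triangle ε (x m * (y m - y′ n)) (y′ n * (x m - x′ n))
           (split (x m) (y m) (x′ n) (y′ n)))
         left right
    where
    split : ∀ a b c d → a * b - c * d ≡ a * (b - d) + d * (a - c)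
    split = solve 4 (λ a b c d → a :* b :- c :* d := (a :* (b :- d)) :+ (d :* (a :- c))) ≡.refl

    left : ∃[ N ] (∀ m n → N ℕ.≤ m → N ℕ.≤ n → ∣ x m * (y m - y′ n) ∣ < ½ * ε)
    left =
      let B , B⁺ , M , f = bounded (~-trans p (~-sym p))
          open Scaled B {{B⁺}}
      in
      both (λ {m} {n} → scaled-* (½ * ε) (x m) (y m - y′ n) (half ε 0<ε))
           (M , λ m n i j → f m i) (q .closeTo (1/ B * (½ * ε)) (scaled⁺ (½ * ε) (half ε 0<ε)))

    right : ∃[ N ] (∀ m n → N ℕ.≤ m → N ℕ.≤ n → ∣ y′ n * (x m - x′ n) ∣ < ½ * ε)
    right =
      let B , B⁺ , M , f = bounded (~-trans (~-sym q) q)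
          open Scaled B {{B⁺}}
      in
      both (λ {m} {n} → scaled-* (½ * ε) (y′ n) (x m - x′ n) (half ε 0<ε))
           (M , λ m n i j → f n j) (p .closeTo (1/ B * (½ * ε)) (scaled⁺ (½ * ε) (half ε 0<ε)))

  const : ℚ → ℝ
  const q = mkℝ (λ _ → q) (close λ ε 0<ε → 0 , λ _ _ _ _ → ≡.subst (λ d → ∣ d ∣ < ε) (≡.sym (+-inverseʳ q)) 0<ε)

  infixl 6 _+ᴿ_
  infixl 7 _*ᴿ_
  _+ᴿ_ _*ᴿ_ : ℝ → ℝ → ℝ
  mkℝ x p +ᴿ mkℝ y q = mkℝ (λ n → x n + y n) (+-cong~ {x} p q)
  mkℝ x p *ᴿ mkℝ y q = mkℝ (λ n → x n * y n) (*-cong~ {x} p q)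

  -ᴿ_ : ℝ → ℝ
  -ᴿ mkℝ x p = mkℝ (λ n → - x n) (-‿cong~ {x} p)

  private
    pointwise : ∀ x y → (∀ n → seq x n ≡ seq y n) → seq x ~ seq y
    pointwise x y x≗y = ~-respʳ x≗y (cauchy x)

  ℝ-commutativeRing : CommutativeRing 0ℓ 0ℓ
  ℝ-commutativeRing = record
    { Carrier = ℝ
    ; _≈_     = λ x y → seq x ~ seq y
    ; _+_     = _+ᴿ_
    ; _*_     = _*ᴿ_
    ; -_      = -ᴿ_
    ; 0#      = const 0ℚ
    ; 1#      = const 1ℚ
    ; isCommutativeRing = record
      { isRing = record
        { +-isAbelianGroup = record
          { isGroup = record
            { isMonoid = record
              { isSemigroup = record
                { isMagma = record
                  { isEquivalence = record
                    { refl = λ {x} → cauchy x ; sym = ~-sym ; trans = ~-trans }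
                  ; ∙-cong = +-cong~ }
                ; assoc = λ x y z → pointwise ((x +ᴿ y) +ᴿ z) (x +ᴿ (y +ᴿ z))
                    (λ n → +-assoc (seq x n) (seq y n) (seq z n)) }
              ; identity =
                  (λ x → pointwise (const 0ℚ +ᴿ x) x (λ n → +-identityˡ (seq x n)))
                , (λ x → pointwise (x +ᴿ const 0ℚ) x (λ n → +-identityʳ (seq x n))) }
            ; inverse =
                (λ x → pointwise (-ᴿ x +ᴿ x) (const 0ℚ) (λ n → +-inverseˡ (seq x n)))
              , (λ x → pointwise (x +ᴿ -ᴿ x) (const 0ℚ) (λ n → +-inverseʳ (seq x n)))
            ; ⁻¹-cong = -‿cong~ }
          ; comm = λ x y → pointwise (x +ᴿ y) (y +ᴿ x) (λ n → +-comm (seq x n) (seq y n)) }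
        ; *-cong = *-cong~
        ; *-assoc = λ x y z → pointwise ((x *ᴿ y) *ᴿ z) (x *ᴿ (y *ᴿ z))
            (λ n → *-assoc (seq x n) (seq y n) (seq z n))
        ; *-identity =
            (λ x → pointwise (const 1ℚ *ᴿ x) x (λ n → *-identityˡ (seq x n)))
          , (λ x → pointwise (x *ᴿ const 1ℚ) x (λ n → *-identityʳ (seq x n)))
        ; distrib =
            (λ x y z → pointwise (x *ᴿ (y +ᴿ z)) ((x *ᴿ y) +ᴿ (x *ᴿ z))
              (λ n → *-distribˡ-+ (seq x n) (seq y n) (seq z n)))
          , (λ x y z → pointwise ((y +ᴿ z) *ᴿ x) ((y *ᴿ x) +ᴿ (z *ᴿ x))
              (λ n → *-distribʳ-+ (seq x n) (seq y n) (seq z n))) }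
      ; *-comm = λ x y → pointwise (x *ᴿ y) (y *ᴿ x) (λ n → *-comm (seq x n) (seq y n)) } }

open Real using (ℝ; ℝ-commutativeRing)

-- Pairs (a , b) standing for a + b√-1.
adjoin-i : ∀ {c ℓ} → CommutativeRing c ℓ → CommutativeRing c ℓ
adjoin-i R = record
  { Carrier = Carrier × Carrier
  ; _≈_ = λ (a , b) (c , d) → a ≈ c × b ≈ d
  ; _+_ = λ (a , b) (c , d) → a + c , b + d
  ; _*_ = λ (a , b) (c , d) → a * c - b * d , a * d + b * c
  ; -_  = λ (a , b) → - a , - b
  ; 0#  = 0# , 0#
  ; 1#  = 1# , 0#
  ; isCommutativeRing = record
    { isRing = record
      { +-isAbelianGroup = record
        { isGroup = record
          { isMonoid = record
            { isSemigroup = record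
              { isMagma = record
                { isEquivalence = record
                  { refl  = refl , refl
                  ; sym   = λ (p , q) → sym p , sym q
                  ; trans = λ (p , q) (r , s) → trans p r , trans q s }
                ; ∙-cong = λ (p , q) (r , s) → +-cong p r , +-cong q s }
              ; assoc = λ _ _ _ → +-assoc _ _ _ , +-assoc _ _ _ }
            ; identity = (λ _ → +-identityˡ _ , +-identityˡ _)
                       , (λ _ → +-identityʳ _ , +-identityʳ _) }
          ; inverse = (λ _ → -‿inverseˡ _ , -‿inverseˡ _)
                    , (λ _ → -‿inverseʳ _ , -‿inverseʳ _)
          ; ⁻¹-cong = λ (p , q) → -‿cong p , -‿cong q }
        ; comm = λ _ _ → +-comm _ _ , +-comm _ _ }
      ; *-cong = λ (p , q) (r , s) →
          +-cong (*-cong p r) (-‿cong (*-cong q s)) , +-cong (*-cong p s) (*-cong q r)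
      ; *-assoc = assoc
      ; *-identity = *-idˡ , λ x → transᶜ (comm x _) (*-idˡ x)
      ; distrib =
            distribˡᶜ
          , λ x y z → transᶜ (comm (_ , _) x) (transᶜ (distribˡᶜ x y z)
              (+-cong (proj₁ (comm x y)) (proj₁ (comm x z)) , +-cong (proj₂ (comm x y)) (proj₂ (comm x z))))
      }
    ; *-comm = comm } }
  where
  open CommutativeRing R
  open import Algebra.Properties.Ring ring using (-0#≈0#; -1*x≈-x)
  open NatSolver commutativeSemiring using (solve; _:+_; _:*_; _:=_)

  transᶜ : ∀ {x y z : Carrier × Carrier} →
           proj₁ x ≈ proj₁ y × proj₂ x ≈ proj₂ y → proj₁ y ≈ proj₁ z × proj₂ y ≈ proj₂ z →
           proj₁ x ≈ proj₁ z × proj₂ x ≈ proj₂ z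
  transᶜ (p , q) (r , s) = trans p r , trans q s

  comm : ∀ ((a , b) (c , d) : Carrier × Carrier) →
         a * c - b * d ≈ c * a - d * b × a * d + b * c ≈ c * b + d * a
  comm (a , b) (c , d) =
      +-cong (*-comm a c) (-‿cong (*-comm b d))
    , trans (+-comm _ _) (+-cong (*-comm b c) (*-comm a d))

  *-idˡ : ∀ ((a , b) : Carrier × Carrier) → 1# * a - 0# * b ≈ a × 1# * b + 0# * a ≈ b
  *-idˡ (a , b) =
      trans (+-cong (*-identityˡ a) (trans (-‿cong (zeroˡ b)) -0#≈0#)) (+-identityʳ a)
    , trans (+-cong (*-identityˡ b) (zeroˡ a)) (+-identityʳ b)

  neg : ∀ x → - x ≈ - 1# * x
  neg x = sym (-1*x≈-x x)

  assoc : ∀ ((a , b) (c , d) (e , f) : Carrier × Carrier) →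
          (a * c - b * d) * e - (a * d + b * c) * f ≈ a * (c * e - d * f) - b * (c * f + d * e)
        × (a * c - b * d) * f + (a * d + b * c) * e ≈ a * (c * f + d * e) + b * (c * e - d * f)
  assoc (a , b) (c , d) (e , f) =
      trans (+-cong (*-congʳ (+-congˡ (neg _))) (neg _))
        (trans (solve 7 (λ m a b c d e f →
            (a :* c :+ m :* (b :* d)) :* e :+ m :* ((a :* d :+ b :* c) :* f)
            := a :* (c :* e :+ m :* (d :* f)) :+ m :* (b :* (c :* f :+ d :* e))) refl (- 1#) a b c d e f)
          (sym (+-cong (*-congˡ (+-congˡ (neg _))) (neg _))))
    , trans (+-congʳ (*-congʳ (+-congˡ (neg _))))
        (trans (solve 7 (λ m a b c d e f →
            (a :* c :+ m :* (b :* d)) :* f :+ (a :* d :+ b :* c) :* e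
            := a :* (c :* f :+ d :* e) :+ b :* (c :* e :+ m :* (d :* f))) refl (- 1#) a b c d e f)
          (sym (+-congˡ (*-congˡ (+-congˡ (neg _))))))

  distribˡᶜ : ∀ ((a , b) (c , d) (e , f) : Carrier × Carrier) →
              a * (c + e) - b * (d + f) ≈ (a * c - b * d) + (a * e - b * f)
            × a * (d + f) + b * (c + e) ≈ (a * d + b * c) + (a * f + b * e)
  distribˡᶜ (a , b) (c , d) (e , f) =
      trans (+-congˡ (neg _))
        (trans (solve 7 (λ m a b c d e f →
            a :* (c :+ e) :+ m :* (b :* (d :+ f))
            := (a :* c :+ m :* (b :* d)) :+ (a :* e :+ m :* (b :* f))) refl (- 1#) a b c d e f)
          (sym (+-cong (+-congˡ (neg _)) (+-congˡ (neg _)))))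
    , solve 6 (λ a b c d e f →
        a :* (d :+ f) :+ b :* (c :+ e) := (a :* d :+ b :* c) :+ (a :* f :+ b :* e)) refl a b c d e f

ℂ : CommutativeRing 0ℓ 0ℓ
ℂ = adjoin-i ℝ-commutativeRing

-- A polynomial is its list of coefficients, constant term first; lists that
-- differ by trailing zeros are identified by _≋_.
module Polynomials {c ℓ} (R : CommutativeRing c ℓ) where
  open CommutativeRing R
  open import Algebra.Properties.Ring ring using (-0#≈0#)

  Poly : Set c
  Poly = List Carrier

  coeff : Poly → ℕ → Carrier
  coeff []      _       = 0#
  coeff (a ∷ p) zero    = a
  coeff (a ∷ p) (suc k) = coeff p k

  infix 4 _≋_
  record _≋_ (p q : Poly) : Set ℓ where
    constructor coeffs
    field
      at : ∀ k → coeff p k ≈ coeff q k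

  open _≋_ public

  infixl 6 _⊞_
  _⊞_ : Poly → Poly → Poly
  []      ⊞ q       = q
  (a ∷ p) ⊞ []      = a ∷ p
  (a ∷ p) ⊞ (b ∷ q) = a + b ∷ p ⊞ q

  ⊟_ : Poly → Poly
  ⊟_ = map (λ a → - a)

  infixl 7 _·_ _⊠_
  _·_ : Carrier → Poly → Poly
  a · p = map (a *_) p

  _⊠_ : Poly → Poly → Poly
  []      ⊠ q = []
  (a ∷ p) ⊠ q = a · q ⊞ (0# ∷ p ⊠ q)

  1+t : Poly
  1+t = 1# ∷ 1# ∷ []

  coeff-⊞ : ∀ p q k → coeff (p ⊞ q) k ≈ coeff p k + coeff q k
  coeff-⊞ []      q       k       = sym (+-identityˡ _)
  coeff-⊞ (a ∷ p) []      k       = sym (+-identityʳ _)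
  coeff-⊞ (a ∷ p) (b ∷ q) zero    = refl
  coeff-⊞ (a ∷ p) (b ∷ q) (suc k) = coeff-⊞ p q k

  coeff-⊟ : ∀ p k → coeff (⊟ p) k ≈ - coeff p k
  coeff-⊟ []      k       = sym -0#≈0#
  coeff-⊟ (a ∷ p) zero    = refl
  coeff-⊟ (a ∷ p) (suc k) = coeff-⊟ p k

  coeff-· : ∀ a p k → coeff (a · p) k ≈ a * coeff p k
  coeff-· a []      k       = sym (zeroʳ a)
  coeff-· a (b ∷ p) zero    = refl
  coeff-· a (b ∷ p) (suc k) = coeff-· a p k

  ≋-refl : ∀ {p} → p ≋ p
  ≋-refl = coeffs λ _ → refl

  ≋-sym : ∀ {p q} → p ≋ q → q ≋ p
  ≋-sym e = coeffs λ k → sym (e .at k)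

  ≋-trans : ∀ {p q r} → p ≋ q → q ≋ r → p ≋ r
  ≋-trans e f = coeffs λ k → trans (e .at k) (f .at k)

  ∷-cong : ∀ {a b p q} → a ≈ b → p ≋ q → a ∷ p ≋ b ∷ q
  ∷-cong h e = coeffs λ { zero → h ; (suc k) → e .at k }

  ⊞-cong : ∀ {p p′ q q′} → p ≋ p′ → q ≋ q′ → p ⊞ q ≋ p′ ⊞ q′
  ⊞-cong {p} {p′} {q} {q′} e f = coeffs λ k →
    trans (coeff-⊞ p q k) (trans (+-cong (e .at k) (f .at k)) (sym (coeff-⊞ p′ q′ k)))

  ⊟-cong : ∀ {p q} → p ≋ q → ⊟ p ≋ ⊟ q
  ⊟-cong {p} {q} e = coeffs λ k →
    trans (coeff-⊟ p k) (trans (-‿cong (e .at k)) (sym (coeff-⊟ q k)))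

  ·-cong : ∀ {a b p q} → a ≈ b → p ≋ q → a · p ≋ b · q
  ·-cong {a} {b} {p} {q} h e = coeffs λ k →
    trans (coeff-· a p k) (trans (*-cong h (e .at k)) (sym (coeff-· b q k)))

  ⊞-assoc : ∀ p q r → (p ⊞ q) ⊞ r ≋ p ⊞ (q ⊞ r)
  ⊞-assoc []      q       r       = ≋-refl
  ⊞-assoc (a ∷ p) []      r       = ≋-refl
  ⊞-assoc (a ∷ p) (b ∷ q) []      = ≋-refl
  ⊞-assoc (a ∷ p) (b ∷ q) (d ∷ r) = ∷-cong (+-assoc a b d) (⊞-assoc p q r)

  ⊞-comm : ∀ p q → p ⊞ q ≋ q ⊞ p
  ⊞-comm []      []      = ≋-refl
  ⊞-comm []      (b ∷ q) = ≋-refl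
  ⊞-comm (a ∷ p) []      = ≋-refl
  ⊞-comm (a ∷ p) (b ∷ q) = ∷-cong (+-comm a b) (⊞-comm p q)

  ⊞-identityʳ : ∀ p → p ⊞ [] ≋ p
  ⊞-identityʳ p = ⊞-comm p []

  ⊞-inverseˡ : ∀ p → ⊟ p ⊞ p ≋ []
  ⊞-inverseˡ p = coeffs λ k →
    trans (coeff-⊞ (⊟ p) p k) (trans (+-congʳ (coeff-⊟ p k)) (-‿inverseˡ (coeff p k)))

  ⊞-commutativeMonoid : CommutativeMonoid c ℓ
  ⊞-commutativeMonoid = record
    { isCommutativeMonoid = record
      { isMonoid = record
        { isSemigroup = record
          { isMagma = record
            { isEquivalence = record { refl = ≋-refl ; sym = ≋-sym ; trans = ≋-trans }
            ; ∙-cong = ⊞-cong }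
          ; assoc = ⊞-assoc }
        ; identity = (λ _ → ≋-refl) , ⊞-identityʳ }
      ; comm = ⊞-comm } }

  open SetoidReasoning (CommutativeMonoid.setoid ⊞-commutativeMonoid)
  open import Algebra.Properties.CommutativeSemigroup
    (CommutativeMonoid.commutativeSemigroup ⊞-commutativeMonoid) using (x∙yz≈y∙xz; interchange)

  0∷[] : 0# ∷ [] ≋ []
  0∷[] = coeffs λ { zero → refl ; (suc _) → refl }

  0· : ∀ p → 0# · p ≋ []
  0· p = coeffs λ k → trans (coeff-· 0# p k) (zeroˡ _)

  1· : ∀ p → 1# · p ≋ p
  1· p = coeffs λ k → trans (coeff-· 1# p k) (*-identityˡ _)

  ·⊞ : ∀ a p q → a · (p ⊞ q) ≋ a · p ⊞ a · q
  ·⊞ a []      q       = ≋-refl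
  ·⊞ a (b ∷ p) []      = ≋-refl
  ·⊞ a (b ∷ p) (d ∷ q) = ∷-cong (distribˡ a b d) (·⊞ a p q)

  *· : ∀ a b p → (a * b) · p ≋ a · (b · p)
  *· a b []      = ≋-refl
  *· a b (d ∷ p) = ∷-cong (*-assoc a b d) (*· a b p)

  ⊠-congˡ : ∀ p {q q′} → q ≋ q′ → p ⊠ q ≋ p ⊠ q′
  ⊠-congˡ []      e = ≋-refl
  ⊠-congˡ (a ∷ p) e = ⊞-cong (·-cong refl e) (∷-cong refl (⊠-congˡ p e))

  ⊠-zeroʳ : ∀ p → p ⊠ [] ≋ []
  ⊠-zeroʳ []      = ≋-refl
  ⊠-zeroʳ (a ∷ p) = ≋-trans (∷-cong refl (⊠-zeroʳ p)) 0∷[]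

  ⊠-∷ : ∀ p b q → p ⊠ (b ∷ q) ≋ b · p ⊞ (0# ∷ p ⊠ q)
  ⊠-∷ []      b q = ≋-sym 0∷[]
  ⊠-∷ (a ∷ p) b q = ∷-cong (+-congʳ (*-comm a b))
    (≋-trans (⊞-cong ≋-refl (⊠-∷ p b q)) (x∙yz≈y∙xz (a · q) (b · p) (0# ∷ p ⊠ q)))

  ⊠-comm : ∀ p q → p ⊠ q ≋ q ⊠ p
  ⊠-comm p []      = ⊠-zeroʳ p
  ⊠-comm p (b ∷ q) = ≋-trans (⊠-∷ p b q) (⊞-cong ≋-refl (∷-cong refl (⊠-comm p q)))

  ⊠-cong : ∀ {p p′ q q′} → p ≋ p′ → q ≋ q′ → p ⊠ q ≋ p′ ⊠ q′
  ⊠-cong {p} {p′} {q} {q′} e f = begin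
    p ⊠ q    ≈⟨ ⊠-congˡ p f ⟩
    p ⊠ q′   ≈⟨ ⊠-comm p q′ ⟩
    q′ ⊠ p   ≈⟨ ⊠-congˡ q′ e ⟩
    q′ ⊠ p′  ≈⟨ ⊠-comm q′ p′ ⟩
    p′ ⊠ q′  ∎

  ⊠-distribˡ : ∀ p q r → p ⊠ (q ⊞ r) ≋ p ⊠ q ⊞ p ⊠ r
  ⊠-distribˡ []      q r = ≋-refl
  ⊠-distribˡ (a ∷ p) q r = begin
    a · (q ⊞ r) ⊞ (0# ∷ p ⊠ (q ⊞ r))
      ≈⟨ ⊞-cong (·⊞ a q r) (∷-cong (sym (+-identityˡ 0#)) (⊠-distribˡ p q r)) ⟩
    (a · q ⊞ a · r) ⊞ ((0# ∷ p ⊠ q) ⊞ (0# ∷ p ⊠ r))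
      ≈⟨ interchange (a · q) (a · r) (0# ∷ p ⊠ q) (0# ∷ p ⊠ r) ⟩
    (a · q ⊞ (0# ∷ p ⊠ q)) ⊞ (a · r ⊞ (0# ∷ p ⊠ r)) ∎

  ⊠-distribʳ : ∀ r p q → (p ⊞ q) ⊠ r ≋ p ⊠ r ⊞ q ⊠ r
  ⊠-distribʳ r p q = begin
    (p ⊞ q) ⊠ r      ≈⟨ ⊠-comm (p ⊞ q) r ⟩
    r ⊠ (p ⊞ q)      ≈⟨ ⊠-distribˡ r p q ⟩
    r ⊠ p ⊞ r ⊠ q    ≈⟨ ⊞-cong (⊠-comm r p) (⊠-comm r q) ⟩
    p ⊠ r ⊞ q ⊠ r    ∎

  ·⊠ : ∀ a p q → (a · p) ⊠ q ≋ a · (p ⊠ q)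
  ·⊠ a []      q = ≋-refl
  ·⊠ a (b ∷ p) q = begin
    (a * b) · q ⊞ (0# ∷ (a · p) ⊠ q)    ≈⟨ ⊞-cong (*· a b q) (∷-cong (sym (zeroʳ a)) (·⊠ a p q)) ⟩
    a · (b · q) ⊞ a · (0# ∷ p ⊠ q)      ≈⟨ ·⊞ a (b · q) (0# ∷ p ⊠ q) ⟨
    a · (b · q ⊞ (0# ∷ p ⊠ q))          ∎

  ⊠-assoc : ∀ p q r → (p ⊠ q) ⊠ r ≋ p ⊠ (q ⊠ r)
  ⊠-assoc []      q r = ≋-refl
  ⊠-assoc (a ∷ p) q r = begin
    (a · q ⊞ (0# ∷ p ⊠ q)) ⊠ r
      ≈⟨ ⊠-distribʳ r (a · q) (0# ∷ p ⊠ q) ⟩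
    (a · q) ⊠ r ⊞ (0# · r ⊞ (0# ∷ (p ⊠ q) ⊠ r))
      ≈⟨ ⊞-cong (·⊠ a q r) (⊞-cong (0· r) (∷-cong refl (⊠-assoc p q r))) ⟩
    a · (q ⊠ r) ⊞ (0# ∷ p ⊠ (q ⊠ r)) ∎

  ⊠-identityˡ : ∀ p → (1# ∷ []) ⊠ p ≋ p
  ⊠-identityˡ p = begin
    1# · p ⊞ (0# ∷ [])  ≈⟨ ⊞-cong (1· p) 0∷[] ⟩
    p ⊞ []              ≈⟨ ⊞-identityʳ p ⟩
    p                   ∎

_[t] : ∀ {c ℓ} → CommutativeRing c ℓ → CommutativeRing c ℓ
R [t] = record
  { Carrier = Poly
  ; _≈_     = _≋_
  ; _+_     = _⊞_
  ; _*_     = _⊠_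
  ; -_      = ⊟_
  ; 0#      = []
  ; 1#      = 1# ∷ []
  ; isCommutativeRing = record
    { isRing = record
      { +-isAbelianGroup = record
        { isGroup = record
          { isMonoid = CommutativeMonoid.isMonoid ⊞-commutativeMonoid
          ; inverse  = ⊞-inverseˡ , λ p → ≋-trans (⊞-comm p (⊟ p)) (⊞-inverseˡ p)
          ; ⁻¹-cong  = ⊟-cong }
        ; comm = ⊞-comm }
      ; *-cong     = ⊠-cong
      ; *-assoc    = ⊠-assoc
      ; *-identity = ⊠-identityˡ , λ p → ≋-trans (⊠-comm p (1# ∷ [])) (⊠-identityˡ p)
      ; distrib    = ⊠-distribˡ , ⊠-distribʳ }
    ; *-comm = ⊠-comm } }
  where
  open CommutativeRing R using (1#)
  open Polynomials R

-- The multiset of edges, as the multiplicity of each unordered pair.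
record Graph (n : ℕ) : Set where
  field
    multiplicity     : Fin n → Fin n → ℕ
    multiplicity-sym : ∀ u v → multiplicity u v ≡ multiplicity v u

open Graph public

infix 4 _≐_
_≐_ : ∀ {n} → Graph n → Graph n → Set
G ≐ H = ∀ u v → multiplicity G u v ≡ multiplicity H u v

Distinct : ∀ {n} → Graph n → Graph n → Set
Distinct G H = ¬ (G ≐ H)

record Simple {n} (G : Graph n) : Set where
  field
    noLoops      : ∀ v → multiplicity G v v ≡ 0
    noMultiEdges : ∀ u v → multiplicity G u v ℕ.≤ 1

-- Multiplicity in E(H) of a pair of vertices of a possibly larger vertex set
-- [N] ⊇ [n].
multiplicityIn : ∀ {n} → Graph n → ∀ {N} → Fin N → Fin N → ℕ
multiplicityIn {n} H u v with toℕ u ℕₚ.<? n | toℕ v ℕₚ.<? n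
... | yes u<n | yes v<n = multiplicity H (fromℕ< u<n) (fromℕ< v<n)
... | _       | _       = 0

multiplicityIn-sym : ∀ {n} (H : Graph n) {N} (u v : Fin N) →
                     multiplicityIn H u v ≡ multiplicityIn H v u
multiplicityIn-sym {n} H u v with toℕ u ℕₚ.<? n | toℕ v ℕₚ.<? n
... | yes u<n | yes v<n = multiplicity-sym H (fromℕ< u<n) (fromℕ< v<n)
... | yes _   | no _    = ≡.refl
... | no _    | yes _   = ≡.refl
... | no _    | no _    = ≡.refl

infixl 6 _⊎ᴱ_
_⊎ᴱ_ : ∀ {N n} → Graph N → Graph n → Graph N
G ⊎ᴱ H = record
  { multiplicity     = λ u v → multiplicity G u v ℕ.+ multiplicityIn H u v
  ; multiplicity-sym = λ u v → ≡.cong₂ ℕ._+_ (multiplicity-sym G u v) (multiplicityIn-sym H u v)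
  }

-- Colours 0, …, m-1 stand for x₁, …, x_m.
Colouring : ℕ → ℕ → Set
Colouring n m = Vec (Fin m) n

Proper : ∀ {n m} → Graph n → Colouring n m → Set
Proper G κ = ∀ u v → multiplicity G u v ≢ 0 → lookup κ u ≢ lookup κ v

proper? : ∀ {n m} (G : Graph n) (κ : Colouring n m) → Dec (Proper G κ)
proper? G κ = Finₚ.all? λ u → Finₚ.all? λ v →
  ¬? (multiplicity G u v ℕₚ.≟ 0) →-dec ¬? (lookup κ u Finₚ.≟ lookup κ v)

-- e(κ); restricting to u ≤ v counts each unordered pair once.
monochromaticEdges : ∀ {n m} → Graph n → Colouring n m → ℕ
monochromaticEdges G κ = sum (tabulate λ u → sum (tabulate λ v →
  if does (u Finₚ.≤? v) ∧ does (lookup κ u Finₚ.≟ lookup κ v) then multiplicity G u v else 0))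

-- The exponents of the monomial ∏_v x_{κ(v)}.
exponents : ∀ {n m} → Colouring n m → Vec ℕ m
exponents κ = tabulate λ c → count (c Finₚ.≟_) κ

permute : ∀ {m} → Permutation′ m → Vec ℕ m → Vec ℕ m
permute π α = tabulate λ c → lookup α (π ⟨$⟩ʳ c)

private
  lookup-map-⇔ : ∀ {n m m′} (f : Fin m → Fin m′) → Injective _≡_ _≡_ f → (κ : Colouring n m) →
                 ∀ u v → lookup (Vec.map f κ) u ≡ lookup (Vec.map f κ) v ⇔ lookup κ u ≡ lookup κ v
  lookup-map-⇔ f inj κ u v rewrite Vecₚ.lookup-map u f κ | Vecₚ.lookup-map v f κ =
    mk⇔ inj (≡.cong f)

  count-map : ∀ {n m m′} (f : Fin m → Fin m′) {c c′} → (∀ d → c′ ≡ f d ⇔ c ≡ d) →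
              (κ : Colouring n m) → count (c′ Finₚ.≟_) (Vec.map f κ) ≡ count (c Finₚ.≟_) κ
  count-map f e []      = ≡.refl
  count-map f {c} {c′} e (d ∷ κ)
    rewrite does-⇔ (e d) (c′ Finₚ.≟ f d) (c Finₚ.≟ d) | count-map f e κ = ≡.refl

  count-any : ∀ {n m} (c : Fin m) {κ : Colouring n m} → Any (c ≡_) κ → count (c Finₚ.≟_) κ ≢ 0
  count-any c {d ∷ κ} (here c≡d) eq rewrite dec-true (c Finₚ.≟ d) c≡d with () ← eq
  count-any c {d ∷ κ} (there i)  eq with does (c Finₚ.≟ d)
  ... | true  with () ← eq
  ... | false = count-any c i eq

  count-absent : ∀ {n m} (c : Fin m) (κ : Colouring n m) → ¬ Any (c ≡_) κ → count (c Finₚ.≟_) κ ≡ 0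
  count-absent c []      ∉ = ≡.refl
  count-absent c (d ∷ κ) ∉ rewrite dec-false (c Finₚ.≟ d) (∉ ∘ here) = count-absent c κ (∉ ∘ there)

  tabulate-∷ʳ : ∀ {m} (f : Fin (suc m) → ℕ) → tabulate f ≡ tabulate (f ∘ inject₁) ∷ʳ f (fromℕ m)
  tabulate-∷ʳ {zero}  f = ≡.refl
  tabulate-∷ʳ {suc m} f = ≡.cong (f zero ∷_) (tabulate-∷ʳ (f ∘ suc))

  sum-tabulate-suc : ∀ {m} (d : Fin m) {f g : Fin m → ℕ} → f d ≡ suc (g d) →
                     (∀ c → c ≢ d → f c ≡ g c) → sum (tabulate f) ≡ suc (sum (tabulate g))
  sum-tabulate-suc zero    {f} {g} p q = ≡.cong₂ ℕ._+_ p
    (≡.cong sum (Vecₚ.tabulate-cong λ c → q (suc c) λ ()))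
  sum-tabulate-suc (suc d) {f} {g} p q = ≡.trans
    (≡.cong₂ ℕ._+_ (q zero λ ()) (sum-tabulate-suc d p λ c c≢d → q (suc c) (c≢d ∘ Finₚ.suc-injective)))
    (ℕₚ.+-suc (g zero) _)

  sum-tabulate-0 : ∀ m → sum (tabulate {n = m} λ _ → 0) ≡ 0
  sum-tabulate-0 zero    = ≡.refl
  sum-tabulate-0 (suc m) = sum-tabulate-0 m

exponents-inject₁ : ∀ {n m} (κ : Colouring n m) → exponents (Vec.map inject₁ κ) ≡ exponents κ ∷ʳ 0
exponents-inject₁ {m = m} κ = ≡.trans (tabulate-∷ʳ λ c → count (c Finₚ.≟_) (Vec.map inject₁ κ))
  (≡.cong₂ _∷ʳ_
    (Vecₚ.tabulate-cong λ c → count-map inject₁ (λ d → mk⇔ Finₚ.inject₁-injective (≡.cong inject₁)) κ)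
    (count-absent (fromℕ m) _ (absent κ)))
  where
  absent : ∀ {n} (κ : Colouring n m) → ¬ Any (fromℕ m ≡_) (Vec.map inject₁ κ)
  absent (d ∷ κ) (here eq) = Finₚ.fromℕ≢inject₁ eq
  absent (d ∷ κ) (there i) = absent κ i

exponents-permute : ∀ {n m} (π : Permutation′ m) (κ : Colouring n m) →
                    exponents (Vec.map (π ⟨$⟩ˡ_) κ) ≡ permute π (exponents κ)
exponents-permute π κ = Vecₚ.tabulate-cong λ c → ≡.trans
  (count-map (π ⟨$⟩ˡ_) (λ d → mk⇔
    (λ { ≡.refl → Perm.inverseʳ π })
    (λ { ≡.refl → ≡.sym (Perm.inverseˡ π) })) κ)
  (≡.sym (Vecₚ.lookup∘tabulate (λ c → count (c Finₚ.≟_) κ) (π ⟨$⟩ʳ c)))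

sum-exponents : ∀ {n m} (κ : Colouring n m) → sum (exponents κ) ≡ n
sum-exponents {m = m} []      = sum-tabulate-0 m
sum-exponents         (d ∷ κ) = ≡.trans (sum-tabulate-suc d here′ there′) (≡.cong suc (sum-exponents κ))
  where
  here′ : count (d Finₚ.≟_) (d ∷ κ) ≡ suc (count (d Finₚ.≟_) κ)
  here′ rewrite dec-true (d Finₚ.≟ d) ≡.refl = ≡.refl
  there′ : ∀ c → c ≢ d → count (c Finₚ.≟_) (d ∷ κ) ≡ count (c Finₚ.≟_) κ
  there′ c c≢d rewrite dec-false (c Finₚ.≟ d) c≢d = ≡.refl

⟨$⟩ˡ-injective : ∀ {m} (π : Permutation′ m) → Injective _≡_ _≡_ (π ⟨$⟩ˡ_)
⟨$⟩ˡ-injective π eq = ≡.trans (≡.sym (Perm.inverseʳ π)) (≡.trans (≡.cong (π ⟨$⟩ʳ_) eq) (Perm.inverseʳ π))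

permute-injective : ∀ {m} (π : Permutation′ m) {α β : Vec ℕ m} → permute π α ≡ permute π β → α ≡ β
permute-injective π {α} {β} eq = ≡.trans (≡.sym (Vecₚ.tabulate∘lookup α))
  (≡.trans (Vecₚ.tabulate-cong λ c → begin
      lookup α c                          ≡⟨ at α c ⟨
      lookup (permute π α) (π ⟨$⟩ˡ c)     ≡⟨ ≡.cong (λ γ → lookup γ (π ⟨$⟩ˡ c)) eq ⟩
      lookup (permute π β) (π ⟨$⟩ˡ c)     ≡⟨ at β c ⟩
      lookup β c                          ∎)
    (Vecₚ.tabulate∘lookup β))
  where
  open ≡.≡-Reasoning
  at : ∀ γ c → lookup (permute π γ) (π ⟨$⟩ˡ c) ≡ lookup γ c
  at γ c = ≡.trans (Vecₚ.lookup∘tabulate _ (π ⟨$⟩ˡ c)) (≡.cong (lookup γ) (Perm.inverseʳ π))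

module Symmetric {a ℓ} (R : CommutativeRing a ℓ) where
  open CommutativeRing R
  open import Algebra.Properties.CommutativeMonoid.Sum +-commutativeMonoid
    using (sum-cong-≋; sum-permute; sum-replicate-zero; sum-init-last) renaming (sum to ∑)

  -- A formal power series in x₁, x₂, …, given by the coefficients of all
  -- x₁^α₁ ⋯ x_m^α_m, that is symmetric and of bounded degree.
  record Λ : Set (a ⊔ˡ ℓ) where
    field
      coefficient : ∀ {m} → Vec ℕ m → Carrier
      stable      : ∀ {m} (α : Vec ℕ m) → coefficient (α ∷ʳ 0) ≈ coefficient α
      symmetric   : ∀ {m} (π : Permutation′ m) (α : Vec ℕ m) → coefficient (permute π α) ≈ coefficient α
      degree      : ℕ
      bounded     : ∀ {m} (α : Vec ℕ m) → degree ℕ.< sum α → coefficient α ≈ 0#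

  open Λ public

  infix 4 _≈ᴧ_
  record _≈ᴧ_ (f g : Λ) : Set (a ⊔ˡ ℓ) where
    constructor coefficientwise
    field
      at : ∀ {m} (α : Vec ℕ m) → coefficient f α ≈ coefficient g α

  open _≈ᴧ_ public

  0ᴧ : Λ
  0ᴧ = record
    { coefficient = λ _ → 0#
    ; stable      = λ _ → refl
    ; symmetric   = λ _ _ → refl
    ; degree      = 0
    ; bounded     = λ _ _ → refl
    }

  infixl 6 _+ᴧ_
  _+ᴧ_ : Λ → Λ → Λ
  f +ᴧ g = record
    { coefficient = λ α → coefficient f α + coefficient g α
    ; stable      = λ α → +-cong (stable f α) (stable g α)
    ; symmetric   = λ π α → +-cong (symmetric f π α) (symmetric g π α)
    ; degree      = degree f ⊔ degree g
    ; bounded     = λ α d<α → trans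
        (+-cong (bounded f α (ℕₚ.≤-<-trans (ℕₚ.m≤m⊔n (degree f) (degree g)) d<α))
                (bounded g α (ℕₚ.≤-<-trans (ℕₚ.m≤n⊔m (degree f) (degree g)) d<α)))
        (+-identityˡ 0#)
    }

  infixr 7 _·ᴧ_
  _·ᴧ_ : Carrier → Λ → Λ
  c ·ᴧ f = record
    { coefficient = λ α → c * coefficient f α
    ; stable      = λ α → *-congˡ (stable f α)
    ; symmetric   = λ π α → *-congˡ (symmetric f π α)
    ; degree      = degree f
    ; bounded     = λ α d<α → trans (*-congˡ (bounded f α d<α)) (zeroʳ c)
    }

  ∑Colourings : ∀ n m → (Colouring n m → Carrier) → Carrier
  ∑Colourings zero    m w = w []
  ∑Colourings (suc n) m w = ∑ λ c → ∑Colourings n m λ κ → w (c ∷ κ)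

  ∑Colourings-cong : ∀ n {m} {w w′ : Colouring n m → Carrier} → (∀ κ → w κ ≈ w′ κ) →
                     ∑Colourings n m w ≈ ∑Colourings n m w′
  ∑Colourings-cong zero    e = e []
  ∑Colourings-cong (suc n) e = sum-cong-≋ λ c → ∑Colourings-cong n λ κ → e (c ∷ κ)

  ∑Colourings-0 : ∀ n {m} {w : Colouring n m → Carrier} → (∀ κ → w κ ≈ 0#) → ∑Colourings n m w ≈ 0#
  ∑Colourings-0 zero        e = e []
  ∑Colourings-0 (suc n) {m} e = trans
    (sum-cong-≋ λ c → ∑Colourings-0 n λ κ → e (c ∷ κ)) (sum-replicate-zero m)

  ∑Colourings-permute : ∀ n {m} (π : Permutation′ m) (w : Colouring n m → Carrier) →
                        ∑Colourings n m w ≈ ∑Colourings n m λ κ → w (Vec.map (π ⟨$⟩ʳ_) κ)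
  ∑Colourings-permute zero    π w = refl
  ∑Colourings-permute (suc n) π w = trans
    (sum-permute (λ c → ∑Colourings n _ λ κ → w (c ∷ κ)) π)
    (sum-cong-≋ λ c → ∑Colourings-permute n π λ κ → w ((π ⟨$⟩ʳ c) ∷ κ))

  ∑Colourings-inject₁ : ∀ n {m} (w : Colouring n (suc m) → Carrier) →
                        (∀ κ → Any (fromℕ m ≡_) κ → w κ ≈ 0#) →
                        ∑Colourings n (suc m) w ≈ ∑Colourings n m λ κ → w (Vec.map inject₁ κ)
  ∑Colourings-inject₁ zero    w e = refl
  ∑Colourings-inject₁ (suc n) {m} w e = trans
    (sum-init-last λ c → ∑Colourings n (suc m) λ κ → w (c ∷ κ))
    (trans
      (+-cong
        (sum-cong-≋ λ c → ∑Colourings-inject₁ n (λ κ → w (inject₁ c ∷ κ)) λ κ i → e _ (there i))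
        (∑Colourings-0 n λ κ → e _ (here ≡.refl)))
      (+-identityʳ _))

  -- A weight on colourings that does not depend on the names of the colours.
  record Weight (n : ℕ) : Set (a ⊔ˡ ℓ) where
    field
      weight    : ∀ {m} → Colouring n m → Carrier
      invariant : ∀ {m m′} (f : Fin m → Fin m′) → Injective _≡_ _≡_ f →
                  (κ : Colouring n m) → weight (Vec.map f κ) ≈ weight κ

  -- ∑_κ w(κ) ∏_v x_{κ(v)}.  Only colourings with colours in {1, …, m}
  -- contribute to the coefficient of x₁^α₁ ⋯ x_m^α_m.
  generatingFunction : ∀ {n} → Weight n → Λ
  generatingFunction {n} w = record
    { coefficient = λ α → ∑Colourings n _ (term α)
    ; stable      = stable′
    ; symmetric   = symmetric′
    ; degree      = n
    ; bounded     = λ α n<α → ∑Colourings-0 n λ κ → off α κ λ eq →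
        ℕₚ.<-irrefl (≡.trans (≡.sym (sum-exponents κ)) (≡.cong sum eq)) n<α
    }
    where
    open Weight w

    _≟_ : ∀ {m} (α β : Vec ℕ m) → Dec (α ≡ β)
    _≟_ = Vecₚ.≡-dec ℕₚ._≟_

    term : ∀ {m} → Vec ℕ m → Colouring n m → Carrier
    term α κ = if does (exponents κ ≟ α) then weight κ else 0#

    off : ∀ {m} (α : Vec ℕ m) κ → exponents κ ≢ α → term α κ ≈ 0#
    off α κ ne rewrite dec-false (exponents κ ≟ α) ne = refl

    term-map : ∀ {m m′} (f : Fin m → Fin m′) → Injective _≡_ _≡_ f → (α : Vec ℕ m) (β : Vec ℕ m′) →
               ∀ κ → exponents (Vec.map f κ) ≡ β ⇔ exponents κ ≡ α → term β (Vec.map f κ) ≈ term α κ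
    term-map f inj α β κ e
      rewrite does-⇔ e (exponents (Vec.map f κ) ≟ β) (exponents κ ≟ α) with does (exponents κ ≟ α)
    ... | true  = invariant f inj κ
    ... | false = refl

    stable′ : ∀ {m} (α : Vec ℕ m) → ∑Colourings n (suc m) (term (α ∷ʳ 0)) ≈ ∑Colourings n m (term α)
    stable′ {m} α = trans
      (∑Colourings-inject₁ n (term (α ∷ʳ 0)) λ κ i → off (α ∷ʳ 0) κ λ eq →
        count-any (fromℕ m) i (Vecₚ.∷ʳ-injectiveʳ _ α (≡.trans (≡.sym (tabulate-∷ʳ λ c → count (c Finₚ.≟_) κ)) eq)))
      (∑Colourings-cong n λ κ → term-map inject₁ Finₚ.inject₁-injective α (α ∷ʳ 0) κ (mk⇔
        (λ eq → Vecₚ.∷ʳ-injectiveˡ _ α (≡.trans (≡.sym (exponents-inject₁ κ)) eq))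
        (λ eq → ≡.trans (exponents-inject₁ κ) (≡.cong (_∷ʳ 0) eq))))

    symmetric′ : ∀ {m} (π : Permutation′ m) (α : Vec ℕ m) →
                 ∑Colourings n m (term (permute π α)) ≈ ∑Colourings n m (term α)
    symmetric′ π α = trans
      (∑Colourings-permute n (Perm.flip π) (term (permute π α)))
      (∑Colourings-cong n λ κ → term-map (π ⟨$⟩ˡ_) (⟨$⟩ˡ-injective π) α (permute π α) κ (mk⇔
        (λ eq → permute-injective π (≡.trans (≡.sym (exponents-permute π κ)) eq))
        (λ eq → ≡.trans (exponents-permute π κ) (≡.cong (permute π) eq))))

module _ {a ℓ} (R : CommutativeRing a ℓ) where
  open CommutativeRing R
  open Symmetric R

  X : ∀ {n} → Graph n → Λ
  X G = generatingFunction record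
    { weight    = λ κ → if does (proper? G κ) then 1# else 0#
    ; invariant = λ f inj κ → reflexive (≡.cong (if_then 1# else 0#)
        (does-⇔ (invariant f inj κ) (proper? G (Vec.map f κ)) (proper? G κ)))
    }
    where
    open Equivalence using (to; from)
    invariant : ∀ {m m′} (f : Fin m → Fin m′) → Injective _≡_ _≡_ f → ∀ κ →
                Proper G (Vec.map f κ) ⇔ Proper G κ
    invariant f inj κ = mk⇔
      (λ p u v e eq → p u v e (from (lookup-map-⇔ f inj κ u v) eq))
      (λ p u v e eq → p u v e (to (lookup-map-⇔ f inj κ u v) eq))

module _ {a ℓ} (R : CommutativeRing a ℓ) where
  open CommutativeRing (R [t])
  open import Algebra.Properties.Semiring.Exp semiring using (_^_)
  open Symmetric (R [t])
  open Polynomials R using (1+t)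

  -- Symmetric functions over R[t] are the same as polynomials in t over
  -- symmetric functions: Λ(R[t]) = Λ(R)[t].
  XB : ∀ {n} → Graph n → Λ
  XB G = generatingFunction record
    { weight    = λ κ → 1+t ^ monochromaticEdges G κ
    ; invariant = λ f inj κ → reflexive (≡.cong (1+t ^_) (invariant f inj κ))
    }
    where
    invariant : ∀ {m m′} (f : Fin m → Fin m′) → Injective _≡_ _≡_ f → ∀ κ →
                monochromaticEdges G (Vec.map f κ) ≡ monochromaticEdges G κ
    invariant f inj κ = ≡.cong sum (Vecₚ.tabulate-cong λ u → ≡.cong sum (Vecₚ.tabulate-cong λ v →
      ≡.cong (λ b → if does (u Finₚ.≤? v) ∧ b then multiplicity G u v else 0)
        (does-⇔ (lookup-map-⇔ f inj κ u v) (lookup (Vec.map f κ) u Finₚ.≟ lookup (Vec.map f κ) v)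
                (lookup κ u Finₚ.≟ lookup κ v))))

module Combinations {a ℓ} (R : CommutativeRing a ℓ) where
  open CommutativeRing R
  open Symmetric R

  -- Formal linear combinations are lists of terms.  They represent elements
  -- of the free module on graphs; the linear extension below does not depend
  -- on the choice of list.
  𝔾 : Set a
  𝔾 = List (Carrier × ∃[ n ] (1 ℕ.≤ n) × Graph n)

  𝔾[_] : ℕ → Set a
  𝔾[ n ] = List (Carrier × Graph n)

  _⊖_ : ∀ {n} → Graph n → Graph n → 𝔾[ n ]
  H₁ ⊖ H₂ = (1# , H₁) ∷ (- 1# , H₂) ∷ []

  linear : (∀ {n} → Graph n → Λ) → 𝔾 → Λ
  linear Φ []                    = 0ᴧ
  linear Φ ((c , _ , _ , G) ∷ L) = c ·ᴧ Φ G +ᴧ linear Φ L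

  _∈Ker_ : 𝔾 → (∀ {n} → Graph n → Λ) → Set (a ⊔ˡ ℓ)
  L ∈Ker Φ = linear Φ L ≈ᴧ 0ᴧ

  Ext : ∀ {n N} → 1 ℕ.≤ N → 𝔾[ n ] → Graph N → 𝔾
  Ext {N = N} 1≤N L G = map (λ (c , H) → c , N , 1≤N , G ⊎ᴱ H) L

  IsModularRelation : (∀ {n} → Graph n → Λ) → ∀ {n} → 1 ℕ.≤ n → 𝔾[ n ] → Set (a ⊔ˡ ℓ)
  IsModularRelation Φ {n} 1≤n L =
    ∀ {N} (n≤N : n ℕ.≤ N) (G : Graph N) → Ext (ℕₚ.≤-trans 1≤n n≤N) L G ∈Ker Φ

ModularForX : ∀ {n} → 1 ℕ.≤ n → Combinations.𝔾[_] ℂ n → Set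
ModularForX = Combinations.IsModularRelation ℂ (X ℂ)

ModularForXB : ∀ {n} → 1 ℕ.≤ n → Combinations.𝔾[_] (ℂ [t]) n → Set
ModularForXB = Combinations.IsModularRelation (ℂ [t]) (XB ℂ)

{-# OPTIONS --safe #-}
-- Let uv be an edge of H₁ but not of H₂, let κ colour [n] with n − 1 colours
-- so that u and v is the only pair of vertices sharing a colour, and let G be
-- the complete graph without the edge uv.  Then G ⊎ H₁ contains a complete
-- graph and has no proper colouring with n − 1 colours, while κ is proper for
-- G ⊎ H₂.  Hence the coefficient of the monomial of κ is 0 in X_{G ⊎ H₁} and a
-- positive integer in X_{G ⊎ H₂}.  Setting t = -1 turns XB into X, so a modular
-- relation H₁ − H₂ for XB would be one for X.
module Submission where

open import Defs
open import Algebra.Bundles using (CommutativeRing)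
import Algebra.Properties.AbelianGroup
import Algebra.Properties.CommutativeMonoid.Sum
import Algebra.Properties.CommutativeSemigroup
import Algebra.Properties.Group
import Algebra.Properties.Ring
import Algebra.Properties.Semiring.Exp
open import Data.Bool.Base using (true; false; if_then_else_; _∧_)
open import Data.Empty using (⊥-elim)
open import Data.Fin.Base as Fin using (Fin; zero; suc; toℕ; punchOut)
import Data.Fin.Properties as Finₚ
open import Data.List.Base using ([]; _∷_)
open import Data.Nat.Base as ℕ using (ℕ; zero; suc; _≤_; s≤s)
import Data.Nat.Properties as ℕₚ
open import Data.Product.Base using (_×_; _,_)
open import Data.Rational.Base as ℚ using (ℚ; 0ℚ; 1ℚ)
import Data.Rational.Properties as ℚₚ
open import Data.Sum.Base using (_⊎_; inj₁; inj₂; [_,_]′)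
open import Data.Vec.Base using (Vec; []; _∷_; tabulate; lookup; sum)
import Data.Vec.Properties as Vecₚ
open import Function.Base using (_∘_)
open import Relation.Binary.PropositionalEquality as ≡ using (_≡_; _≢_)
import Relation.Binary.Reasoning.Setoid as SetoidReasoning
open import Relation.Nullary using (¬_; does; yes; no)
open import Relation.Nullary.Decidable using (dec-true; dec-false)

-- The extension that tells apart an edge from a non-edge.

multiplicityIn-[n] : ∀ {n} (H : Graph n) u v → multiplicityIn H u v ≡ multiplicity H u v
multiplicityIn-[n] {n} H u v with toℕ u ℕₚ.<? n | toℕ v ℕₚ.<? n
... | yes u<n | yes v<n = ≡.cong₂ (multiplicity H) (Finₚ.fromℕ<-toℕ u u<n) (Finₚ.fromℕ<-toℕ v v<n)
... | no u≮n  | _       = ⊥-elim (u≮n (Finₚ.toℕ<n u))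
... | yes _   | no v≮n  = ⊥-elim (v≮n (Finₚ.toℕ<n v))

-- The quotient map of the vertex set that glues `v` to `u`. The classes are named by deleting `v`
-- from the list of vertices, so `v` takes the name of `u`.
merge : ∀ {m} {u v : Fin (suc m)} → v ≢ u → Fin (suc m) → Fin m
merge {v = v} v≢u w with v Finₚ.≟ w
... | yes _   = punchOut v≢u
... | no  v≢w = punchOut v≢w

merge-self : ∀ {m} {u v : Fin (suc m)} (v≢u : v ≢ u) → merge v≢u u ≡ merge v≢u v
merge-self {u = u} {v} v≢u with v Finₚ.≟ u | v Finₚ.≟ v
... | yes v≡u | _      = ⊥-elim (v≢u v≡u)
... | no  _   | yes _  = Finₚ.punchOut-cong v ≡.refl
... | no  _   | no v≢v = ⊥-elim (v≢v ≡.refl)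

-- `punchOut` is injective away from `v`, so a coincidence between distinct vertices involves `v`,
-- and then the other vertex has the name of `u`.
merge-fibres : ∀ {m} {u v : Fin (suc m)} (v≢u : v ≢ u) {x y} → merge v≢u x ≡ merge v≢u y →
               x ≡ y ⊎ (x ≡ u × y ≡ v) ⊎ (x ≡ v × y ≡ u)
merge-fibres {v = v} v≢u {x} {y} eq with v Finₚ.≟ x | v Finₚ.≟ y
... | yes v≡x | yes v≡y = inj₁ (≡.trans (≡.sym v≡x) v≡y)
... | yes v≡x | no  v≢y = inj₂ (inj₂ (≡.sym v≡x , ≡.sym (Finₚ.punchOut-injective v≢u v≢y eq)))
... | no  v≢x | yes v≡y = inj₂ (inj₁ (Finₚ.punchOut-injective v≢x v≢u eq , ≡.sym v≡y))
... | no  v≢x | no  v≢y = inj₁ (Finₚ.punchOut-injective v≢x v≢y eq)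

-- The parts are the fibres of `f`. For `merge` the only part with two elements is that of `u` and
-- `v`, which gives the complete graph minus the edge uv.
completeMultipartite : ∀ {n m} → (Fin n → Fin m) → Graph n
completeMultipartite f = record
  { multiplicity     = λ x y → if does (f x Finₚ.≟ f y) then 0 else 1
  ; multiplicity-sym = sym
  }
  where
  sym : ∀ x y → (if does (f x Finₚ.≟ f y) then 0 else 1) ≡ (if does (f y Finₚ.≟ f x) then 0 else 1)
  sym x y with f x Finₚ.≟ f y
  ... | yes p rewrite dec-true  (f y Finₚ.≟ f x) (≡.sym p)     = ≡.refl
  ... | no ¬p rewrite dec-false (f y Finₚ.≟ f x) (¬p ∘ ≡.sym) = ≡.refl

module _ {m} {u v : Fin (suc m)} (v≢u : v ≢ u) (H : Graph (suc m)) where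
  private
    G : Graph (suc m)
    G = completeMultipartite (merge v≢u)

  adjacent : multiplicity H u v ≢ 0 → ∀ {x y} → x ≢ y → multiplicity (G ⊎ᴱ H) x y ≢ 0
  adjacent uv {x} {y} x≢y eq with merge v≢u x Finₚ.≟ merge v≢u y
  ... | no  _ with () ← eq
  -- The summand from `G` has reduced to 0 here, so `eq` concerns `H` alone.
  ... | yes p with merge-fibres v≢u p | ≡.trans (≡.sym (multiplicityIn-[n] H x y)) eq
  ...   | inj₁ x≡y                        | _ = x≢y x≡y
  ...   | inj₂ (inj₁ (≡.refl , ≡.refl)) | h = uv h
  ...   | inj₂ (inj₂ (≡.refl , ≡.refl)) | h = uv (≡.trans (multiplicity-sym H u v) h)

  no-proper : multiplicity H u v ≢ 0 → ∀ κ → ¬ Proper {m = m} (G ⊎ᴱ H) κ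
  no-proper uv κ p =
    let i , j , i<j , eq = Finₚ.pigeonhole (ℕₚ.n<1+n m) (lookup κ)
    in p i j (adjacent uv (Finₚ.<⇒≢ i<j)) eq

  merge-proper : Simple H → multiplicity H u v ≡ 0 → Proper (G ⊎ᴱ H) (tabulate (merge v≢u))
  merge-proper simple uv x y xy eq = xy (≡.cong₂ ℕ._+_ G-xy (≡.trans (multiplicityIn-[n] H x y) H-xy))
    where
    same : merge v≢u x ≡ merge v≢u y
    same = ≡.trans (≡.sym (Vecₚ.lookup∘tabulate (merge v≢u) x))
             (≡.trans eq (Vecₚ.lookup∘tabulate (merge v≢u) y))

    G-xy : multiplicity G x y ≡ 0
    G-xy rewrite dec-true (merge v≢u x Finₚ.≟ merge v≢u y) same = ≡.refl

    H-xy : multiplicity H x y ≡ 0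
    H-xy with merge-fibres v≢u same
    -- `Proper` ranges over equal vertices too, so loops have to be excluded.
    ... | inj₁ ≡.refl                   = Simple.noLoops simple x
    ... | inj₂ (inj₁ (≡.refl , ≡.refl)) = uv
    ... | inj₂ (inj₂ (≡.refl , ≡.refl)) = ≡.trans (multiplicity-sym H x y) uv

-- Proper colourings as those without monochromatic edges.

sum-tabulate-all-0 : ∀ {n} {f : Fin n → ℕ} → (∀ i → f i ≡ 0) → sum (tabulate f) ≡ 0
sum-tabulate-all-0 {zero}  h = ≡.refl
sum-tabulate-all-0 {suc n} h = ≡.cong₂ ℕ._+_ (h zero) (sum-tabulate-all-0 (h ∘ suc))

sum-tabulate≡0 : ∀ {n} {f : Fin n → ℕ} → sum (tabulate f) ≡ 0 → ∀ i → f i ≡ 0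
sum-tabulate≡0 {f = f} h zero    = ℕₚ.m+n≡0⇒m≡0 (f zero) h
sum-tabulate≡0 {f = f} h (suc i) = sum-tabulate≡0 (ℕₚ.m+n≡0⇒n≡0 (f zero) h) i

module _ {n m} (G : Graph n) (κ : Colouring n m) where

  proper⇒monochromaticEdges≡0 : Proper G κ → monochromaticEdges G κ ≡ 0
  proper⇒monochromaticEdges≡0 p = sum-tabulate-all-0 λ u → sum-tabulate-all-0 λ v → entry u v
    where
    entry : ∀ u v →
      (if does (u Finₚ.≤? v) ∧ does (lookup κ u Finₚ.≟ lookup κ v) then multiplicity G u v else 0) ≡ 0
    entry u v with does (u Finₚ.≤? v) | lookup κ u Finₚ.≟ lookup κ v
    ... | false | _      = ≡.refl
    ... | true  | no _   = ≡.refl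
    ... | true  | yes eq with multiplicity G u v ℕₚ.≟ 0
    ...   | yes h = h
    ...   | no ¬h = ⊥-elim (p u v ¬h eq)

  -- The count only sees pairs with u ≤ v; the remaining pairs follow by symmetry of the
  -- multiplicity.
  monochromaticEdges≡0⇒proper : monochromaticEdges G κ ≡ 0 → Proper G κ
  monochromaticEdges≡0⇒proper h u v uv eq = uv ([ (λ u≤v → ordered u≤v eq)
    , (λ v≤u → ≡.trans (multiplicity-sym G u v) (ordered v≤u (≡.sym eq))) ]′ (Finₚ.≤-total u v))
    where
    ordered : ∀ {u v} → u Fin.≤ v → lookup κ u ≡ lookup κ v → multiplicity G u v ≡ 0
    ordered {u} {v} u≤v eq with sum-tabulate≡0 (sum-tabulate≡0 h u) v
    ... | e rewrite dec-true (u Finₚ.≤? v) u≤v | dec-true (lookup κ u Finₚ.≟ lookup κ v) eq = e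

-- Coefficients under a modular relation.

module _ {a ℓ} (R : CommutativeRing a ℓ) where
  open CommutativeRing R hiding (zero)
  open Symmetric R
  open Combinations R
  open Algebra.Properties.Ring ring using (-1*x≈-x)
  open Algebra.Properties.Group +-group using (x∙y⁻¹≈ε⇒x≈y)

  -- The relation is taken at N = n, where `linear` unfolds to `1# * a + (- 1# * b + 0#)` for the
  -- two coefficients a and b.
  modular⇒coefficient≈ : ∀ (Φ : ∀ {n} → Graph n → Λ) {n} (1≤n : 1 ≤ n) (H₁ H₂ : Graph n) →
    IsModularRelation Φ 1≤n (H₁ ⊖ H₂) → ∀ (G : Graph n) {m} (α : Vec ℕ m) →
    coefficient (Φ (G ⊎ᴱ H₁)) α ≈ coefficient (Φ (G ⊎ᴱ H₂)) α
  modular⇒coefficient≈ Φ 1≤n H₁ H₂ modular G α = x∙y⁻¹≈ε⇒x≈y _ _ (trans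
    (sym (+-cong (*-identityˡ _) (trans (+-identityʳ _) (-1*x≈-x _))))
    (modular ℕₚ.≤-refl G .at α))

  -- The length m of `α` fixes the number of colours: a coefficient in m variables sums over
  -- colourings with m colours, even if more colours would admit proper ones.
  X-no-proper : ∀ {n m} (G : Graph n) → (∀ κ → ¬ Proper G κ) → (α : Vec ℕ m) →
                coefficient (X R G) α ≈ 0#
  X-no-proper {n} G ¬p α = ∑Colourings-0 n term
    where
    term : ∀ κ → (if does (Vecₚ.≡-dec ℕₚ._≟_ (exponents κ) α)
                  then (if does (proper? G κ) then 1# else 0#) else 0#) ≈ 0#
    term κ rewrite dec-false (proper? G κ) (¬p κ) with does (Vecₚ.≡-dec ℕₚ._≟_ (exponents κ) α)
    ... | true  = refl
    ... | false = refl

-- The common consequence of modularity for `X` and for `XB` through which both halves of the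
-- theorem pass.
AgreeOnExtensions : ∀ {a ℓ} → CommutativeRing a ℓ → ∀ {n} → Graph n → Graph n → Set ℓ
AgreeOnExtensions R {n} H₁ H₂ = ∀ (G : Graph n) {m} (α : Vec ℕ m) →
  coefficient (X R (G ⊎ᴱ H₁)) α ≈ coefficient (X R (G ⊎ᴱ H₂)) α
  where
  open CommutativeRing R using (_≈_)
  open Symmetric R using (coefficient)

AgreeOnExtensions-sym : ∀ {a ℓ} (R : CommutativeRing a ℓ) {n} {H₁ H₂ : Graph n} →
                        AgreeOnExtensions R H₁ H₂ → AgreeOnExtensions R H₂ H₁
AgreeOnExtensions-sym R agree G α = CommutativeRing.sym R (agree G α)

-- Specialisation of `XB` to `X` at t = -1.

module _ {a ℓ} (R : CommutativeRing a ℓ) where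
  open CommutativeRing R hiding (zero)
  open Polynomials R
  open Symmetric
  open SetoidReasoning setoid
  open Algebra.Properties.Ring ring using (-0#≈0#)
  open Algebra.Properties.AbelianGroup +-abelianGroup using (⁻¹-∙-comm)
  open Algebra.Properties.CommutativeSemigroup +-commutativeSemigroup using (interchange)
  open Algebra.Properties.CommutativeMonoid.Sum +-commutativeMonoid
    using (sum-cong-≋) renaming (sum to ∑)
  open Algebra.Properties.CommutativeMonoid.Sum (CommutativeRing.+-commutativeMonoid (R [t]))
    using () renaming (sum to ∑[t])
  open Algebra.Properties.Semiring.Exp (CommutativeRing.semiring (R [t])) using (_^_)

  x-0≈x : ∀ x → x - 0# ≈ x
  x-0≈x x = trans (+-congˡ -0#≈0#) (+-identityʳ x)

  -- Evaluation at t = -1 by Horner's rule.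
  at-1 : Poly → Carrier
  at-1 []      = 0#
  at-1 (a ∷ p) = a - at-1 p

  -- Lists of different lengths can represent one polynomial; the surplus entries are then zero and
  -- contribute nothing.
  at-1-cong : ∀ {p q} → p ≋ q → at-1 p ≈ at-1 q
  at-1-cong {p} {q} e = go p q (e .at)
    where
    go : ∀ p q → (∀ k → coeff p k ≈ coeff q k) → at-1 p ≈ at-1 q
    go []      []      e = refl
    go []      (b ∷ q) e = sym (trans (+-cong (sym (e 0)) (-‿cong (sym (go [] q (e ∘ suc))))) (x-0≈x 0#))
    go (a ∷ p) []      e = trans (+-cong (e 0) (-‿cong (go p [] (e ∘ suc)))) (x-0≈x 0#)
    go (a ∷ p) (b ∷ q) e = +-cong (e 0) (-‿cong (go p q (e ∘ suc)))

  at-1-⊞ : ∀ p q → at-1 (p ⊞ q) ≈ at-1 p + at-1 q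
  at-1-⊞ []      q       = sym (+-identityˡ _)
  at-1-⊞ (a ∷ p) []      = sym (+-identityʳ _)
  at-1-⊞ (a ∷ p) (b ∷ q) = begin
    a + b - at-1 (p ⊞ q)            ≈⟨ +-congˡ (-‿cong (at-1-⊞ p q)) ⟩
    a + b - (at-1 p + at-1 q)       ≈⟨ +-congˡ (⁻¹-∙-comm (at-1 p) (at-1 q)) ⟨
    a + b + (- at-1 p - at-1 q)     ≈⟨ interchange a b (- at-1 p) (- at-1 q) ⟩
    (a - at-1 p) + (b - at-1 q)     ∎

  -- The product unfolds to p + t p up to trivial terms, and multiplication by t changes the sign of
  -- the value at -1.
  at-1-1+t⊠ : ∀ p → at-1 (1+t ⊠ p) ≈ 0#
  at-1-1+t⊠ p = begin
    at-1 (1# · p ⊞ (0# ∷ 1# · p ⊞ (0# ∷ [])))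
      ≈⟨ at-1-⊞ (1# · p) (0# ∷ 1# · p ⊞ (0# ∷ [])) ⟩
    at-1 (1# · p) + (0# - at-1 (1# · p ⊞ (0# ∷ [])))
      ≈⟨ +-cong (at-1-cong (1· p)) (trans (+-identityˡ _) (-‿cong (at-1-cong (⊠-identityˡ p)))) ⟩
    at-1 p - at-1 p
      ≈⟨ -‿inverseʳ (at-1 p) ⟩
    0# ∎

  at-1-∑Colourings : ∀ n {m} (w : Colouring n m → Poly) →
                     at-1 (∑Colourings (R [t]) n m w) ≈ ∑Colourings R n m (at-1 ∘ w)
  at-1-∑Colourings zero    w = refl
  at-1-∑Colourings (suc n) w = trans
    (at-1-∑ λ c → ∑Colourings (R [t]) n _ λ κ → w (c ∷ κ))
    (sum-cong-≋ λ c → at-1-∑Colourings n λ κ → w (c ∷ κ))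
    where
    at-1-∑ : ∀ {m} (f : Fin m → Poly) → at-1 (∑[t] f) ≈ ∑ (at-1 ∘ f)
    at-1-∑ {zero}  f = refl
    at-1-∑ {suc m} f = trans (at-1-⊞ (f zero) (∑[t] (f ∘ suc))) (+-congˡ (at-1-∑ (f ∘ suc)))

  -- The weight of κ becomes 0 to the power e(κ), which is 1 if κ is proper and 0 otherwise.
  at-1-XB : ∀ {n m} (G : Graph n) (α : Vec ℕ m) →
            at-1 (coefficient (XB R G) α) ≈ coefficient (X R G) α
  at-1-XB {n} G α = trans (at-1-∑Colourings n _) (∑Colourings-cong R n term)
    where
    weight : ∀ κ → at-1 (1+t ^ monochromaticEdges G κ) ≈ (if does (proper? G κ) then 1# else 0#)
    weight κ with monochromaticEdges G κ in eq
    ... | zero  rewrite dec-true (proper? G κ) (monochromaticEdges≡0⇒proper G κ eq) = x-0≈x 1#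
    ... | suc k rewrite dec-false (proper? G κ)
      (λ p → ℕₚ.0≢1+n (≡.trans (≡.sym (proper⇒monochromaticEdges≡0 G κ p)) eq))
        = at-1-1+t⊠ (1+t ^ k)

    term : ∀ κ →
      at-1 (if does (Vecₚ.≡-dec ℕₚ._≟_ (exponents κ) α) then 1+t ^ monochromaticEdges G κ else [])
      ≈ (if does (Vecₚ.≡-dec ℕₚ._≟_ (exponents κ) α)
         then (if does (proper? G κ) then 1# else 0#) else 0#)
    term κ with does (Vecₚ.≡-dec ℕₚ._≟_ (exponents κ) α)
    ... | true  = weight κ
    ... | false = refl

  X-modular⇒agree : ∀ {n} (1≤n : 1 ≤ n) (H₁ H₂ : Graph n) →
    Combinations.IsModularRelation R (X R) 1≤n (Combinations._⊖_ R H₁ H₂) →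
    AgreeOnExtensions R H₁ H₂
  X-modular⇒agree = modular⇒coefficient≈ R (X R)

  XB-modular⇒agree : ∀ {n} (1≤n : 1 ≤ n) (H₁ H₂ : Graph n) →
    Combinations.IsModularRelation (R [t]) (XB R) 1≤n (Combinations._⊖_ (R [t]) H₁ H₂) →
    AgreeOnExtensions R H₁ H₂
  XB-modular⇒agree 1≤n H₁ H₂ modular G α = begin
    coefficient (X R (G ⊎ᴱ H₁)) α          ≈⟨ at-1-XB (G ⊎ᴱ H₁) α ⟨
    at-1 (coefficient (XB R (G ⊎ᴱ H₁)) α)  ≈⟨ at-1-cong (modular⇒coefficient≈ (R [t]) (XB R) 1≤n H₁ H₂ modular G α) ⟩
    at-1 (coefficient (XB R (G ⊎ᴱ H₂)) α)  ≈⟨ at-1-XB (G ⊎ᴱ H₂) α ⟩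
    coefficient (X R (G ⊎ᴱ H₂)) α          ∎

-- Positivity of coefficients over `ℂ`.

module _ where
  open CommutativeRing ℂ hiding (zero)
  open Symmetric ℂ
  open Algebra.Properties.CommutativeMonoid.Sum +-commutativeMonoid using () renaming (sum to ∑)

  -- The bound holds for the terms of the representing sequence, not just for
  -- the limit, so it is not invariant under ≈.
  AtLeast : ℚ → Carrier → Set
  AtLeast q (x , _) = ∀ k → q ℚ.≤ Real.seq x k

  AtLeast-+ : ∀ {p q} z w → AtLeast p z → AtLeast q w → AtLeast (p ℚ.+ q) (z + w)
  AtLeast-+ _ _ h k i = ℚₚ.+-mono-≤ (h i) (k i)

  -- With ε = 1, equality with 0 forces some term of the real part to have absolute value below 1.
  AtLeast-1⇒≉0 : ∀ z → AtLeast 1ℚ z → ¬ z ≈ 0#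
  AtLeast-1⇒≉0 _ h (x~0 , _) with Real.closeTo x~0 1ℚ (ℚₚ.positive⁻¹ 1ℚ)
  ... | N , close = ℚₚ.<-irrefl ≡.refl (ℚₚ.≤-<-trans
    (≡.subst (λ q → 1ℚ ℚ.≤ ℚ.∣ q ∣) (≡.sym (ℚₚ.+-identityʳ _))
      (≡.subst (1ℚ ℚ.≤_) (≡.sym (ℚₚ.0≤p⇒∣p∣≡p (ℚₚ.≤-trans (ℚₚ.nonNegative⁻¹ 1ℚ) (h N)))) (h N)))
    (close N N ℕₚ.≤-refl ℕₚ.≤-refl))

  ∑-nonNegative : ∀ {m} (f : Fin m → Carrier) → (∀ c → AtLeast 0ℚ (f c)) → AtLeast 0ℚ (∑ f)
  ∑-nonNegative {zero}  f h = λ _ → ℚₚ.≤-refl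
  ∑-nonNegative {suc m} f h = AtLeast-+ (f zero) (∑ (f ∘ suc)) (h zero) (∑-nonNegative (f ∘ suc) (h ∘ suc))

  ∑-positive : ∀ {m} (f : Fin m → Carrier) → (∀ c → AtLeast 0ℚ (f c)) →
               ∀ c → AtLeast 1ℚ (f c) → AtLeast 1ℚ (∑ f)
  -- The closed sums `1ℚ ℚ.+ 0ℚ` and, in the next clause, `0ℚ ℚ.+ 1ℚ` compute to `1ℚ`.
  ∑-positive f h zero    h₁ = AtLeast-+ (f zero) (∑ (f ∘ suc)) h₁ (∑-nonNegative (f ∘ suc) (h ∘ suc))
  ∑-positive f h (suc c) h₁ = AtLeast-+ (f zero) (∑ (f ∘ suc)) (h zero) (∑-positive (f ∘ suc) (h ∘ suc) c h₁)

  ∑Colourings-nonNegative : ∀ n {m} (w : Colouring n m → Carrier) → (∀ κ → AtLeast 0ℚ (w κ)) →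
                            AtLeast 0ℚ (∑Colourings n m w)
  ∑Colourings-nonNegative zero    w h = h []
  ∑Colourings-nonNegative (suc n) w h = ∑-nonNegative (λ c → ∑Colourings n _ λ κ → w (c ∷ κ))
    λ c → ∑Colourings-nonNegative n (λ κ → w (c ∷ κ)) λ κ → h (c ∷ κ)

  ∑Colourings-positive : ∀ n {m} (w : Colouring n m → Carrier) → (∀ κ → AtLeast 0ℚ (w κ)) →
                         ∀ κ → AtLeast 1ℚ (w κ) → AtLeast 1ℚ (∑Colourings n m w)
  ∑Colourings-positive zero    w h []      h₁ = h₁
  ∑Colourings-positive (suc n) w h (c ∷ κ) h₁ = ∑-positive (λ c → ∑Colourings n _ λ κ → w (c ∷ κ))
    (λ c → ∑Colourings-nonNegative n (λ κ → w (c ∷ κ)) λ κ → h (c ∷ κ)) c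
    (∑Colourings-positive n (λ κ → w (c ∷ κ)) (λ κ → h (c ∷ κ)) κ h₁)

  -- Nothing cancels: every colouring contributes 0 or 1 to this coefficient, and κ itself
  -- contributes 1.
  X-proper : ∀ {n m} (G : Graph n) (κ : Colouring n m) → Proper G κ →
             ¬ coefficient (X ℂ G) (exponents κ) ≈ 0#
  X-proper {n} {m} G κ p = AtLeast-1⇒≉0 (coefficient (X ℂ G) (exponents κ))
    (∑Colourings-positive n term nonNegative κ one)
    where
    term : Colouring n m → Carrier
    term κ′ = if does (Vecₚ.≡-dec ℕₚ._≟_ (exponents κ′) (exponents κ))
              then (if does (proper? G κ′) then 1# else 0#) else 0#

    nonNegative : ∀ κ′ → AtLeast 0ℚ (term κ′)
    nonNegative κ′ with does (Vecₚ.≡-dec ℕₚ._≟_ (exponents κ′) (exponents κ)) | does (proper? G κ′)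
    ... | true  | true  = λ _ → ℚₚ.nonNegative⁻¹ 1ℚ
    ... | true  | false = λ _ → ℚₚ.≤-refl
    ... | false | _     = λ _ → ℚₚ.≤-refl

    one : AtLeast 1ℚ (term κ)
    one rewrite dec-true (Vecₚ.≡-dec ℕₚ._≟_ (exponents κ) (exponents κ)) ≡.refl
              | dec-true (proper? G κ) p = λ _ → ℚₚ.≤-refl

  -- Recovering the edges of a simple graph from its extensions.

  edge⇒edge : ∀ {n} {H₁ H₂ : Graph n} → Simple H₁ → Simple H₂ → AgreeOnExtensions ℂ H₁ H₂ →
              ∀ u v → multiplicity H₁ u v ≢ 0 → multiplicity H₂ u v ≢ 0
  -- The vertex `u` makes n a successor, and its predecessor m is the number of colours.
  edge⇒edge {suc m} {H₁} {H₂} simple₁ simple₂ agree u v uv₁ uv₂ =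
    X-proper (G ⊎ᴱ H₂) κ (merge-proper v≢u H₂ simple₂ uv₂)
      (begin
        coefficient (X ℂ (G ⊎ᴱ H₂)) (exponents κ)  ≈⟨ agree G (exponents κ) ⟨
        coefficient (X ℂ (G ⊎ᴱ H₁)) (exponents κ)  ≈⟨ X-no-proper ℂ (G ⊎ᴱ H₁) (no-proper v≢u H₁ uv₁) (exponents κ) ⟩
        0#                                         ∎)
    where
    open SetoidReasoning setoid

    v≢u : v ≢ u
    v≢u ≡.refl = uv₁ (Simple.noLoops simple₁ v)

    G : Graph (suc m)
    G = completeMultipartite (merge v≢u)

    κ : Colouring (suc m) m
    κ = tabulate (merge v≢u)

  -- Multiplicities of at most 1 are determined by whether they vanish, and agreement is symmetric,
  -- so edges transfer both ways.
  agree⇒≐ : ∀ {n} {H₁ H₂ : Graph n} → Simple H₁ → Simple H₂ → AgreeOnExtensions ℂ H₁ H₂ → H₁ ≐ H₂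
  agree⇒≐ simple₁ simple₂ agree u v = ≤1-≡ (noMultiEdges simple₁ u v) (noMultiEdges simple₂ u v)
    (edge⇒edge simple₁ simple₂ agree u v)
    (edge⇒edge simple₂ simple₁ (AgreeOnExtensions-sym ℂ agree) u v)
    where
    open Simple using (noMultiEdges)
    ≤1-≡ : ∀ {i j} → i ≤ 1 → j ≤ 1 → (i ≢ 0 → j ≢ 0) → (j ≢ 0 → i ≢ 0) → i ≡ j
    ≤1-≡ {0}           {0}           _        _        _ _ = ≡.refl
    ≤1-≡ {0}           {suc _}       _        _        _ g = ⊥-elim (g (λ ()) ≡.refl)
    ≤1-≡ {suc _}       {0}           _        _        f _ = ⊥-elim (f (λ ()) ≡.refl)
    ≤1-≡ {1}           {1}           _        _        _ _ = ≡.refl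
    ≤1-≡ {suc (suc _)} {_}           (s≤s ()) _        _ _
    ≤1-≡ {_}           {suc (suc _)} _        (s≤s ()) _ _

corollary7 : (n : ℕ) (1≤n : 1 ≤ n) (H₁ H₂ : Graph n) →
    Simple H₁ → Simple H₂ → Distinct H₁ H₂ →
    ¬ ModularForX 1≤n (Combinations._⊖_ ℂ H₁ H₂)
    × ¬ ModularForXB 1≤n (Combinations._⊖_ (ℂ [t]) H₁ H₂)
corollary7 n 1≤n H₁ H₂ simple₁ simple₂ distinct =
    (λ modular → distinct (agree⇒≐ simple₁ simple₂ (X-modular⇒agree ℂ 1≤n H₁ H₂ modular)))
  , (λ modular → distinct (agree⇒≐ simple₁ simple₂ (XB-modular⇒agree ℂ 1≤n H₁ H₂ modular)))
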